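{- For every variable $x\in V$, every command $c\in\mathcal C$ and every reflexive relation $g\subseteq\Sigma\times\Sigma$, $$(\mathbf{var}\,x\cdot c\Cap\mathbf{guar}\,g)\;=\;(\mathbf{var}\,x\cdot c\Cap\mathbf{guar}\,g)\Cap\mathbf{guar}\big((\mathsf E_x g)\cap\mathrm{id}(x)\big).$$
   Context: Commands. $(\mathcal C,\le,\bigwedge,\bigsqcup,\bot,\top)$ is a complete distributive lattice (with arbitrary meet $\bigwedge$, binary meet $\sqcap$, arbitrary join $\bigsqcup$ and binary join $\sqcup$) whose elements are called commands. It has an associative sequential composition $;$ with identity $\mathbf{nil}$, monotone in both arguments, and an associative, commutative, idempotent, monotone weak conjunction $\Cap$. Iterations: $c^0=\mathbf{nil}$, $c^{i+1}=c;c^i$; $c^\star$ (resp. $c^\omega$) is the least (resp. greatest) fixed point of $y\mapsto\mathbf{nil}\sqcup c;y$; $c^\infty=c^\omega;\bot$. One has $c^\star=\bigsqcup_{i\in\mathbb N}c^i$ and $c^\omega=c^\star\sqcup c^\infty$. States and relations. $V$ is a countable set of variables, $S$ a set, $\Sigma$ the set of partial functions $V\rightharpoonup S$. For $W\subseteq V$, $\mathrm{id}(W)$ relates $\sigma,\sigma'\in\Sigma$ iff they agree on every variable in $W$; $\mathrm{id}(x)=\mathrm{id}(\{x\})$, $\mathrm{id}(\overline x)=\mathrm{id}(V\setminus\{x\})$, and $\mathrm{id}$ is the identity relation on $\Sigma$. For $p\subseteq\Sigma$, $\mathsf E_x p$ is the image of $p$ under $\mathrm{id}(\overline x)$. For $r\subseteq\Sigma\times\Sigma$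 (with $\circ$ denoting left-to-right relational composition), $\mathsf E^{\mathsf{first}}_x r=\mathrm{id}(\overline x)\circ r$, $\mathsf E^{\mathsf{last}}_x r=r\circ\mathrm{id}(\overline x)$, $\mathsf E_x r=\mathrm{id}(\overline x)\circ r\circ\mathrm{id}(\overline x)$. $\overline r$ is the complement of $r$. A relation $g$ is reflexive if $\mathrm{id}\subseteq g$. Primitive commands. $\tau:\mathcal P(\Sigma)\to\mathcal C$ (tests) and $\pi,\epsilon:\mathcal P(\Sigma\times\Sigma)\to\mathcal A$ (program and environment steps) are injective homomorphisms of complete Boolean algebras onto complete Boolean sub-algebras of $\mathcal C$ (joins, and nonempty meets, computed in $\mathcal C$; complement relative to the greatest element of the sub-algebra), with $\tau(\emptyset)=\pi(\emptyset)=\epsilon(\emptyset)=\bot$ and $\tau(\Sigma)=\mathbf{nil}$. $\mathcal A\subseteq\mathcal C$ is the complete Boolean sub-algebra of atomic steps, in which $\boldsymbol\pi=\pi(\Sigma\times\Sigma)$ and $\boldsymbol\epsilon=\epsilon(\Sigma\times\Sigma)$ are complementary; $\boldsymbol\alpha=\boldsymbol\pi\sqcup\boldsymbol\epsilon$. $\mathbf{chaos}=\boldsymbol\alpha^\omega$ is the identity of $\Cap$, and $a=a\Cap(\boldsymbol\alpha;\mathbf{chaos})$ for all $a\in\mathcal A$. Localisation. For each $x\in V$ there are unary operators $\mathsf E_x,\mathsf E^{\mathsf{first}}_x,\mathsf E^{\mathsf{last}}_x$ on $\mathcal C$ (binding tighter than binary operators). Each family $F\in\{\mathsf E,\mathsf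 E^{\mathsf{first}},\mathsf E^{\mathsf{last}}\}$ satisfies $c\le F_xc$; $F_x(c\sqcap F_xd)=F_xc\sqcap F_xd$; $F_xF_yc=F_yF_xc$; $F_x(\bigsqcup C)=\bigsqcup_{c\in C}F_xc$. Further axioms: $\mathsf E^{\mathsf{first}}_xc\le\mathsf E_xc$; $\mathsf E^{\mathsf{last}}_xc\le\mathsf E_xc$; $\mathsf E_x\mathsf E^{\mathsf{first}}_yc=\mathsf E^{\mathsf{first}}_y\mathsf E_xc$; $\mathsf E_x\mathsf E^{\mathsf{last}}_yc=\mathsf E^{\mathsf{last}}_y\mathsf E_xc$; $\mathsf E^{\mathsf{first}}_x\mathsf E^{\mathsf{last}}_yc=\mathsf E^{\mathsf{last}}_y\mathsf E^{\mathsf{first}}_xc$; $\mathsf E_x\tau(p)=\mathsf E^{\mathsf{first}}_x\tau(p)=\mathsf E^{\mathsf{last}}_x\tau(p)=\tau(\mathsf E_xp)$; $F_x\pi(r)=\pi(F_xr)$ and $F_x\epsilon(r)=\epsilon(F_xr)$ for each of the three $F$; $\mathsf E_x(c;\mathsf E^{\mathsf{first}}_xd)=\mathsf E_xc;\mathsf E_xd=\mathsf E_x(\mathsf E^{\mathsf{last}}_xc;d)$; if $c=c\Cap(\boldsymbol\alpha;\mathbf{chaos})$ then $\mathsf E^{\mathsf{first}}_x(c;d)=\mathsf E^{\mathsf{first}}_xc;d$ and $\mathsf E^{\mathsf{last}}_x(d;c)=d;\mathsf E^{\mathsf{last}}_xc$; $\mathsf E_x(c\Cap\mathsf E_xd)=\mathsf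 E_xc\Cap\mathsf E_xd$; $\mathsf E^{\mathsf{first}}_x(c\Cap\mathsf E^{\mathsf{first}}_xd)=\mathsf E^{\mathsf{first}}_xc\Cap\mathsf E^{\mathsf{first}}_xd$; for $a\in\mathcal A$ with $\mathsf E_xa=\mathsf E^{\mathsf{last}}_xa$, $\mathsf E_x(a^\infty)=(\mathsf E_xa)^\infty$. Derived commands. $\mathbf{guar}\,g=(\pi(g)\sqcup\boldsymbol\epsilon)^\omega$; $\mathbf{demand}\,r=(\epsilon(r)\sqcup\boldsymbol\pi)^\omega$; $\mathbf{rely}\,r=(\boldsymbol\alpha\sqcup\epsilon(\overline r);\top)^\omega=\boldsymbol\alpha^\omega;(\mathbf{nil}\sqcup\epsilon(\overline r);\top)$; $\mathbf{term}=\boldsymbol\alpha^\star;\boldsymbol\epsilon^\omega$; $\mathbf{idle}=\mathbf{term}\Cap\mathbf{guar}\,\mathrm{id}$. Known properties of the algebra: $\mathbf{guar}\,g_1\Cap\mathbf{guar}\,g_2=\mathbf{guar}(g_1\cap g_2)$; $\mathbf{guar}\,g\Cap(c;d)=(\mathbf{guar}\,g\Cap c);(\mathbf{guar}\,g\Cap d)$; $\mathbf{rely}\,r_1\ge\mathbf{rely}\,r_2$ if $r_1\subseteq r_2$; $\mathbf{rely}\,r\Cap c\ge c$; $\mathbf{rely}\,r_1\Cap\mathbf{rely}\,r_2=\mathbf{rely}(r_1\cap r_2)$; $\mathbf{rely}\,r\Cap(c;d)\ge(\mathbf{rely}\,r\Cap c);(\mathbf{rely}\,r\Cap d)$; $\mathbf{demand}\,r\Cap\mathbf{rely}\,r=\mathbf{demand}\,r$;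 $\mathbf{idle}=\mathbf{idle}\Cap\mathbf{guar}\,g$ if $g$ is reflexive. Local blocks. $(\mathbf{local}\,x\cdot c)=\mathsf E_x(\mathbf{demand}\,\mathrm{id}(x)\Cap c)\Cap\mathbf{guar}\,\mathrm{id}(x)$ and $(\mathbf{var}\,x\cdot c)=\mathbf{idle};(\mathbf{local}\,x\cdot c);\mathbf{idle}$. -}

module Defs where

open import Algebra.Core using (Op₁; Op₂)
open import Algebra.Definitions using (Idempotent)
open import Algebra.Structures using (IsMonoid; IsCommutativeMonoid)
open import Data.Empty.Polymorphic using () renaming (⊥ to Empty)
open import Data.Maybe.Base using (Maybe)
open import Data.Nat.Base using (ℕ)
open import Data.Nat.GeneralisedArithmetic using (fold)
open import Data.Product.Base using (_×_; _,_; ∃; proj₁; uncurry)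
open import Data.Unit.Polymorphic using () renaming (⊤ to Unit)
open import Function.Base using (_∘_)
open import Level using (Level) renaming (suc to lsuc; _⊔_ to _l⊔_)
open import Relation.Binary.Core using (_Preserves₂_⟶_⟶_)
open import Relation.Binary.Definitions using (Maximum; Minimum)
open import Relation.Binary.Lattice using (DistributiveLattice)
open import Relation.Binary.PropositionalEquality.Core using (_≡_)
open import Relation.Unary using (Pred; _∈_; _⊆_; _≐_; _∩_; ∁; ｛_｝; ⋃; ⋂)

-- Relation.Unary.U and Relation.Unary.∅ live at level 0 only.
Full : ∀ {ℓ} {X : Set ℓ} → Pred X ℓ
Full _ = Unit

None : ∀ {ℓ} {X : Set ℓ} → Pred X ℓ
None _ = Empty

------------------------------------------------------------------------
-- States and relations

-- A partial function V ⇀ S is a function V → Maybe S, and 𝒫(X) is Pred X ℓ,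
-- compared by mutual inclusion _≐_.

module States {ℓ : Level} (V S : Set ℓ) where

  State : Set ℓ
  State = V → Maybe S

  StatePred : Set (lsuc ℓ)
  StatePred = Pred State ℓ

  StateRel : Set (lsuc ℓ)
  StateRel = Pred (State × State) ℓ

  id : StateRel
  id = uncurry _≡_

  idOn : Pred V ℓ → StateRel
  idOn W (σ , σ′) = ∀ y → y ∈ W → σ y ≡ σ′ y

  idAt : V → StateRel
  idAt x = idOn ｛ x ｝

  idOff : V → StateRel
  idOff x = idOn (∁ ｛ x ｝)

  -- Left-to-right composition.
  infixr 9 _⨟_
  _⨟_ : StateRel → StateRel → StateRel
  (r ⨟ s) (σ , σ″) = ∃ λ σ′ → r (σ , σ′) × s (σ′ , σ″)

  Eₛ : V → StatePred → StatePred
  Eₛ x p σ′ = ∃ λ σ → p σ × idOff x (σ , σ′)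

  Eᵣ Eᵣfirst Eᵣlast : V → StateRel → StateRel
  Eᵣ      x r = idOff x ⨟ r ⨟ idOff x
  Eᵣfirst x r = idOff x ⨟ r
  Eᵣlast  x r = r ⨟ idOff x

------------------------------------------------------------------------
-- Complete distributive lattices

-- "Distributive" is finite distributivity; no infinite distributive law is
-- assumed.

record CompleteDistributiveLattice (ℓ : Level) : Set (lsuc ℓ) where
  field
    distributiveLattice : DistributiveLattice ℓ ℓ ℓ

  open DistributiveLattice distributiveLattice public
    renaming (_∨_ to infixr 5 _⊔_; _∧_ to infixr 6 _⊓_)

  field
    ⊥ ⊤     : Carrier
    minimum : Minimum _≤_ ⊥
    maximum : Maximum _≤_ ⊤

    ⨆ ⨅     : Pred Carrier ℓ → Carrier
    ⨆-upper : ∀ D {c} → c ∈ D → c ≤ ⨆ D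
    ⨆-least : ∀ D {u} → (∀ {c} → c ∈ D → c ≤ u) → ⨆ D ≤ u
    ⨅-lower : ∀ D {c} → c ∈ D → ⨅ D ≤ c
    ⨅-great : ∀ D {l} → (∀ {c} → c ∈ D → l ≤ c) → l ≤ ⨅ D

  Image : ∀ {i} {I : Set i} → (I → Carrier) → Pred Carrier (i l⊔ ℓ)
  Image f c = ∃ λ i → c ≈ f i

  record IsLeastFixedPoint (f : Op₁ Carrier) (x : Carrier) : Set ℓ where
    field
      fixed : f x ≈ x
      least : ∀ {y} → f y ≈ y → x ≤ y

  record IsGreatestFixedPoint (f : Op₁ Carrier) (x : Carrier) : Set ℓ where
    field
      fixed    : f x ≈ x
      greatest : ∀ {y} → f y ≈ y → y ≤ x

  -- B is a complete Boolean algebra under the order of the lattice, with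
  -- greatest element `top`, whose joins and nonempty meets are those of the
  -- lattice.  The empty join makes ⊥ its least element.
  record IsCompleteBooleanSubalgebra {b} (B : Pred Carrier b) (top : Carrier)
         : Set (lsuc ℓ l⊔ b) where
    field
      resp-≈     : ∀ {c d} → c ≈ d → c ∈ B → d ∈ B
      ⨆-closed   : ∀ D → D ⊆ B → ⨆ D ∈ B
      ⨅-closed   : ∀ D → ∃ D → D ⊆ B → ⨅ D ∈ B
      top∈       : top ∈ B
      ≤top       : ∀ {c} → c ∈ B → c ≤ top
      complement : ∀ {c} → c ∈ B →
                   ∃ λ d → d ∈ B × (c ⊓ d ≈ ⊥) × (c ⊔ d ≈ top)

  -- f is an injective homomorphism of complete Boolean algebras from 𝒫(X)
  -- onto a complete Boolean sub-algebra.  A subset of 𝒫(X) is given as a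
  -- family indexed by a small set I.  Preservation of complements forces
  -- excluded middle at level ℓ, so it is not assumed separately.
  record IsBooleanEmbedding {X : Set ℓ} (f : Pred X ℓ → Carrier)
         : Set (lsuc ℓ) where
    field
      cong       : ∀ {p q} → p ≐ q → f p ≈ f q
      injective  : ∀ {p q} → f p ≈ f q → p ≐ q
      ⋃-homo     : ∀ {I : Set ℓ} (p : I → Pred X ℓ) →
                   f (⋃ I p) ≈ ⨆ (Image (f ∘ p))
      ⋂-homo     : ∀ {I : Set ℓ} → I → (p : I → Pred X ℓ) →
                   f (⋂ I p) ≈ ⨅ (Image (f ∘ p))
      ∁-homo-⊓   : ∀ p → f p ⊓ f (∁ p) ≈ ⊥
      ∁-homo-⊔   : ∀ p → f p ⊔ f (∁ p) ≈ f Full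
      None-homo  : f None ≈ ⊥
      subalgebra : IsCompleteBooleanSubalgebra (Image f) (f Full)

  record IsLocalisation {V : Set ℓ} (F : V → Op₁ Carrier) : Set (lsuc ℓ) where
    field
      cong       : ∀ x {c d} → c ≈ d → F x c ≈ F x d
      increasing : ∀ x c → c ≤ F x c
      ⊓-absorb   : ∀ x c d → F x (c ⊓ F x d) ≈ F x c ⊓ F x d
      commute    : ∀ x y c → F x (F y c) ≈ F y (F x c)
      ⨆-homo     : ∀ x (D : Pred Carrier ℓ) →
                   F x (⨆ D) ≈ ⨆ (Image {I = ∃ D} (F x ∘ proj₁))

------------------------------------------------------------------------
-- The concurrent algebra with localisation

record LocalisationAlgebra {ℓ : Level} (V S : Set ℓ) : Set (lsuc ℓ) where
  open States V S

  field
    completeDistributiveLattice : CompleteDistributiveLattice ℓ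

  open CompleteDistributiveLattice completeDistributiveLattice public
    renaming (Carrier to Command)

  infixr 8 _⨾_
  infixr 7 _⋒_
  infix  9 _^⋆ _^ω _^∞ _^_

  field
    _⨾_          : Op₂ Command
    nil          : Command
    ⨾-nil-monoid : IsMonoid _≈_ _⨾_ nil
    ⨾-mono       : _⨾_ Preserves₂ _≤_ ⟶ _≤_ ⟶ _≤_

    _^⋆ _^ω : Op₁ Command
    ⋆-lfp   : ∀ c → IsLeastFixedPoint    (λ y → nil ⊔ c ⨾ y) (c ^⋆)
    ω-gfp   : ∀ c → IsGreatestFixedPoint (λ y → nil ⊔ c ⨾ y) (c ^ω)

  _^_ : Command → ℕ → Command
  c ^ i = fold nil (c ⨾_) i

  _^∞ : Op₁ Command
  c ^∞ = c ^ω ⨾ ⊥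

  field
    ⋆-⨆   : ∀ c → c ^⋆ ≈ ⨆ (Image (c ^_))
    ω-⋆-∞ : ∀ c → c ^ω ≈ c ^⋆ ⊔ c ^∞

    τ           : StatePred → Command
    π ε         : StateRel → Command
    τ-embedding : IsBooleanEmbedding τ
    π-embedding : IsBooleanEmbedding π
    ε-embedding : IsBooleanEmbedding ε
    τ-Full      : τ Full ≈ nil

  𝛑 : Command
  𝛑 = π Full

  𝛆 : Command
  𝛆 = ε Full

  𝛂 : Command
  𝛂 = 𝛑 ⊔ 𝛆

  chaos : Command
  chaos = 𝛂 ^ω

  field
    -- Since 𝛑 and 𝛆 are complementary in 𝒜, the greatest element of 𝒜 is 𝛂.
    𝒜            : Pred Command ℓ
    𝒜-subalgebra : IsCompleteBooleanSubalgebra 𝒜 𝛂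
    π∈𝒜          : ∀ r → π r ∈ 𝒜
    ε∈𝒜          : ∀ r → ε r ∈ 𝒜
    𝛑⊓𝛆          : 𝛑 ⊓ 𝛆 ≈ ⊥

    _⋒_            : Op₂ Command
    ⋒-chaos-monoid : IsCommutativeMonoid _≈_ _⋒_ chaos
    ⋒-idem         : Idempotent _≈_ _⋒_
    ⋒-mono         : _⋒_ Preserves₂ _≤_ ⟶ _≤_ ⟶ _≤_

  -- c = c ⋒ (𝛂 ; chaos): c cannot terminate without taking a step.
  AtLeastOneStep : Pred Command ℓ
  AtLeastOneStep c = c ≈ c ⋒ (𝛂 ⨾ chaos)

  field
    𝒜-step : ∀ {a} → a ∈ 𝒜 → AtLeastOneStep a

    E Efirst Elast      : V → Op₁ Command
    E-localisation      : IsLocalisation E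
    Efirst-localisation : IsLocalisation Efirst
    Elast-localisation  : IsLocalisation Elast

    Efirst≤E : ∀ x c → Efirst x c ≤ E x c
    Elast≤E  : ∀ x c → Elast x c ≤ E x c

    E-Efirst-comm     : ∀ x y c → E x (Efirst y c) ≈ Efirst y (E x c)
    E-Elast-comm      : ∀ x y c → E x (Elast y c) ≈ Elast y (E x c)
    Efirst-Elast-comm : ∀ x y c → Efirst x (Elast y c) ≈ Elast y (Efirst x c)

    E-τ      : ∀ x p → E x (τ p) ≈ τ (Eₛ x p)
    Efirst-τ : ∀ x p → Efirst x (τ p) ≈ τ (Eₛ x p)
    Elast-τ  : ∀ x p → Elast x (τ p) ≈ τ (Eₛ x p)

    E-π      : ∀ x r → E x (π r) ≈ π (Eᵣ x r)
    Efirst-π : ∀ x r → Efirst x (π r) ≈ π (Eᵣfirst x r)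
    Elast-π  : ∀ x r → Elast x (π r) ≈ π (Eᵣlast x r)

    E-ε      : ∀ x r → E x (ε r) ≈ ε (Eᵣ x r)
    Efirst-ε : ∀ x r → Efirst x (ε r) ≈ ε (Eᵣfirst x r)
    Elast-ε  : ∀ x r → Elast x (ε r) ≈ ε (Eᵣlast x r)

    E-⨾-Efirst : ∀ x c d → E x (c ⨾ Efirst x d) ≈ E x c ⨾ E x d
    E-Elast-⨾  : ∀ x c d → E x c ⨾ E x d ≈ E x (Elast x c ⨾ d)

    Efirst-⨾ : ∀ x {c} d → AtLeastOneStep c → Efirst x (c ⨾ d) ≈ Efirst x c ⨾ d
    Elast-⨾  : ∀ x {c} d → AtLeastOneStep c → Elast x (d ⨾ c) ≈ d ⨾ Elast x c

    E-⋒      : ∀ x c d → E x (c ⋒ E x d) ≈ E x c ⋒ E x d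
    Efirst-⋒ : ∀ x c d → Efirst x (c ⋒ Efirst x d) ≈ Efirst x c ⋒ Efirst x d

    E-∞ : ∀ x {a} → a ∈ 𝒜 → E x a ≈ Elast x a → E x (a ^∞) ≈ (E x a) ^∞

  guar : StateRel → Command
  guar g = (π g ⊔ 𝛆) ^ω

  demand : StateRel → Command
  demand r = (ε r ⊔ 𝛑) ^ω

  rely : StateRel → Command
  rely r = (𝛂 ⊔ ε (∁ r) ⨾ ⊤) ^ω

  term : Command
  term = 𝛂 ^⋆ ⨾ 𝛆 ^ω

  idle : Command
  idle = term ⋒ guar id

  -- Laws of the underlying concurrent algebra that its remaining axioms (not
  -- among the fields above) entail; they are taken as given.
  field
    rely-unfold : ∀ r → rely r ≈ 𝛂 ^ω ⨾ (nil ⊔ ε (∁ r) ⨾ ⊤)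
    guar-⋒      : ∀ g₁ g₂ → guar g₁ ⋒ guar g₂ ≈ guar (g₁ ∩ g₂)
    guar-⨾      : ∀ g c d → guar g ⋒ (c ⨾ d) ≈ (guar g ⋒ c) ⨾ (guar g ⋒ d)
    rely-mono   : ∀ {r₁ r₂} → r₁ ⊆ r₂ → rely r₂ ≤ rely r₁
    rely-remove : ∀ r c → c ≤ rely r ⋒ c
    rely-⋒      : ∀ r₁ r₂ → rely r₁ ⋒ rely r₂ ≈ rely (r₁ ∩ r₂)
    rely-⨾      : ∀ r c d → (rely r ⋒ c) ⨾ (rely r ⋒ d) ≤ rely r ⋒ (c ⨾ d)
    demand-rely : ∀ r → demand r ⋒ rely r ≈ demand r
    idle-guar   : ∀ g → id ⊆ g → idle ≈ idle ⋒ guar g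

  infix 4 local_∙_ var_∙_

  local_∙_ var_∙_ : V → Command → Command
  local x ∙ c = E x (demand (idAt x) ⋒ c) ⋒ guar (idAt x)
  var   x ∙ c = idle ⨾ (local x ∙ c) ⨾ idle

-- Since local x quantifies x away by E x, it suffices that guar (Eᵣ x g), which
-- guar g implies, is a fixed point of E x: E-⋒ then pulls it out of the block.
-- For an atomic step a fixed by E x and Elast x, E-Elast-⨾ makes every finite
-- power a fixed point, E-∞ handles the infinite part, and a ^ω = a ^⋆ ⊔ a ^∞.
-- Finally guar distributes over the sequential composition with idle, which
-- satisfies every reflexive guarantee.

module Submission where

open import Defs
open import Algebra.Bundles using (CommutativeMonoid)
import Algebra.Properties.CommutativeSemigroup as CommutativeSemigroupProperties
open import Algebra.Structures using (IsMonoid; IsCommutativeMonoid)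
open import Data.Nat.Base using (ℕ; zero; suc)
open import Data.Product.Base using (_,_; proj₁; proj₂)
open import Data.Sum.Base using (_⊎_; inj₁; inj₂; [_,_])
open import Data.Unit.Polymorphic using (tt)
open import Function.Bundles using (_↣_)
open import Level using (Level)
open import Relation.Binary.Lattice.Properties.JoinSemilattice using (∨-cong)
import Relation.Binary.Reasoning.PartialOrder as ≤-Reasoning
import Relation.Binary.Reasoning.Setoid as ≈-Reasoning
import Relation.Binary.PropositionalEquality.Core as ≡
open import Relation.Unary using (Pred; _∈_; _⊆_; _≐_; _∩_)

module RelProperties {ℓ : Level} (V S : Set ℓ) where
  open States V S

  idOn-refl : ∀ W → id ⊆ idOn W
  idOn-refl W ≡.refl y y∈W = ≡.refl

  idOn-trans : ∀ W → idOn W ⨟ idOn W ⊆ idOn W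
  idOn-trans W (_ , p , q) y y∈W = ≡.trans (p y y∈W) (q y y∈W)

  Eᵣ-increasing : ∀ x r → r ⊆ Eᵣ x r
  Eᵣ-increasing x r p = _ , idOn-refl _ ≡.refl , _ , p , idOn-refl _ ≡.refl

  Eᵣlast-increasing : ∀ x r → r ⊆ Eᵣlast x r
  Eᵣlast-increasing x r p = _ , p , idOn-refl _ ≡.refl

  Eᵣ-idem : ∀ x r → Eᵣ x (Eᵣ x r) ≐ Eᵣ x r
  Eᵣ-idem x r =
    (λ (_ , i , _ , (_ , j , _ , p , k) , l) →
       _ , idOn-trans _ (_ , i , j) , _ , p , idOn-trans _ (_ , k , l)) ,
    Eᵣ-increasing x (Eᵣ x r)

  -- `Eᵣ x r` already ends in `idOff x`, and a further `idOff x` is absorbed by transitivity. This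
  -- yields the `Elast x` half of the side conditions in `E-ω-fixed`.
  Eᵣlast-Eᵣ : ∀ x r → Eᵣlast x (Eᵣ x r) ≐ Eᵣ x r
  Eᵣlast-Eᵣ x r =
    (λ (_ , (_ , i , _ , p , j) , k) → _ , i , _ , p , idOn-trans _ (_ , j , k)) ,
    Eᵣlast-increasing x (Eᵣ x r)

module AlgebraProperties {ℓ : Level} {V S : Set ℓ} (𝓐 : LocalisationAlgebra V S)
  where
  open States V S
  open RelProperties V S
  open LocalisationAlgebra 𝓐
  open IsBooleanEmbedding using () renaming (cong to embed-cong)
  open IsMonoid ⨾-nil-monoid using () renaming (∙-cong to ⨾-cong)
  open IsCommutativeMonoid ⋒-chaos-monoid using ()
    renaming (∙-cong to ⋒-cong; assoc to ⋒-assoc; comm to ⋒-comm)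

  ⊔-cong : ∀ {a b c d} → a ≈ b → c ≈ d → a ⊔ c ≈ b ⊔ d
  ⊔-cong = ∨-cong joinSemilattice

  ⋒-interchange : ∀ a b c d → (a ⋒ b) ⋒ (c ⋒ d) ≈ (a ⋒ c) ⋒ (b ⋒ d)
  ⋒-interchange = CommutativeSemigroupProperties.interchange
    (CommutativeMonoid.commutativeSemigroup
      record { isCommutativeMonoid = ⋒-chaos-monoid })

  -- Recasts a binary join as an arbitrary one, so that `⨆-closed` and `⨆-homo` apply to `⊔`.
  pair : Command → Command → Pred Command ℓ
  pair c d e = (e ≈ c) ⊎ (e ≈ d)

  ⊔-pair : ∀ c d → c ⊔ d ≈ ⨆ (pair c d)
  ⊔-pair c d = antisym
    (∨-least (⨆-upper _ (inj₁ Eq.refl)) (⨆-upper _ (inj₂ Eq.refl)))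
    (⨆-least _ [ (λ e≈c → trans (reflexive e≈c) (x≤x∨y c d))
               , (λ e≈d → trans (reflexive e≈d) (y≤x∨y c d)) ])

  𝒜-⊔ : ∀ {a b} → a ∈ 𝒜 → b ∈ 𝒜 → (a ⊔ b) ∈ 𝒜
  𝒜-⊔ {a} {b} a∈𝒜 b∈𝒜 = resp-≈ (Eq.sym (⊔-pair a b))
    (⨆-closed _ [ (λ e≈a → resp-≈ (Eq.sym e≈a) a∈𝒜)
                , (λ e≈b → resp-≈ (Eq.sym e≈b) b∈𝒜) ])
    where open IsCompleteBooleanSubalgebra 𝒜-subalgebra

  -- `a ^ω` is also a fixed point of the unfolding for `b`, hence below the greatest one.
  ω-cong-≤ : ∀ {a b} → a ≈ b → a ^ω ≤ b ^ω
  ω-cong-≤ {a} {b} a≈b = IsGreatestFixedPoint.greatest (ω-gfp b) (Eq.trans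
    (⊔-cong Eq.refl (⨾-cong (Eq.sym a≈b) Eq.refl))
    (IsGreatestFixedPoint.fixed (ω-gfp a)))

  ω-cong : ∀ {a b} → a ≈ b → a ^ω ≈ b ^ω
  ω-cong a≈b = antisym (ω-cong-≤ a≈b) (ω-cong-≤ (Eq.sym a≈b))

  module LocalisationProperties {F : V → Command → Command}
                                (F-localisation : IsLocalisation F) where
    open IsLocalisation F-localisation

    ⨆-≤ : ∀ {x u} (D : Pred Command ℓ) →
          (∀ {c} → c ∈ D → F x c ≤ u) → F x (⨆ D) ≤ u
    ⨆-≤ {x} D F≤u = trans (reflexive (⨆-homo x D))
      (⨆-least _ (λ ((_ , c∈D) , e≈Fc) → trans (reflexive e≈Fc) (F≤u c∈D)))

    ⊔-≤ : ∀ {x u c d} → F x c ≤ u → F x d ≤ u → F x (c ⊔ d) ≤ u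
    ⊔-≤ {x} {c = c} {d} Fc≤u Fd≤u = trans (reflexive (cong x (⊔-pair c d)))
      (⨆-≤ (pair c d)
        [ (λ e≈c → trans (reflexive (cong x e≈c)) Fc≤u)
        , (λ e≈d → trans (reflexive (cong x e≈d)) Fd≤u) ])

    ⊔-fixed : ∀ {x c d} → F x c ≈ c → F x d ≈ d → F x (c ⊔ d) ≈ c ⊔ d
    ⊔-fixed {x} {c} {d} Fc≈c Fd≈d = antisym
      (⊔-≤ (trans (reflexive Fc≈c) (x≤x∨y c d))
           (trans (reflexive Fd≈d) (y≤x∨y c d)))
      (increasing x _)

  open IsLocalisation E-localisation using ()
    renaming (cong to E-cong; increasing to E-increasing)
  module EP = LocalisationProperties E-localisation
  module ElastP = LocalisationProperties Elast-localisation

  E-nil : ∀ x → E x nil ≈ nil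
  E-nil x = begin
    E x nil           ≈⟨ E-cong x τ-Full ⟨
    E x (τ Full)      ≈⟨ E-τ x Full ⟩
    -- Every state is reached from itself under `idOff x`.
    τ (Eₛ x Full)     ≈⟨ embed-cong τ-embedding
                           ((λ _ → tt) , (λ _ → _ , tt , idOn-refl _ ≡.refl)) ⟩
    τ Full            ≈⟨ τ-Full ⟩
    nil               ∎
    where open ≈-Reasoning setoid

  -- Induction on the exponent: rewriting the leading `a` as `Elast x a` brings the product into the
  -- form that `E-Elast-⨾` splits.
  E-^-fixed : ∀ {x a} → E x a ≈ a → Elast x a ≈ a → ∀ i → E x (a ^ i) ≈ a ^ i
  E-^-fixed {x}     Ea≈a Ela≈a zero    = E-nil x
  E-^-fixed {x} {a} Ea≈a Ela≈a (suc i) = begin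
    E x (a ⨾ a ^ i)           ≈⟨ E-cong x (⨾-cong Ela≈a Eq.refl) ⟨
    E x (Elast x a ⨾ a ^ i)   ≈⟨ E-Elast-⨾ x a (a ^ i) ⟨
    E x a ⨾ E x (a ^ i)       ≈⟨ ⨾-cong Ea≈a (E-^-fixed Ea≈a Ela≈a i) ⟩
    a ⨾ a ^ i                 ∎
    where open ≈-Reasoning setoid

  E-⋆-≤ : ∀ {x a} → E x a ≈ a → Elast x a ≈ a → E x (a ^⋆) ≤ a ^⋆
  E-⋆-≤ {x} {a} Ea≈a Ela≈a = begin
    E x (a ^⋆)                  ≈⟨ E-cong x (⋆-⨆ a) ⟩
    E x (⨆ (Image (a ^_)))      ≤⟨ EP.⨆-≤ _ (λ (i , e≈aⁱ) → trans
                                     (reflexive (Eq.trans (E-cong x e≈aⁱ)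
                                                          (E-^-fixed Ea≈a Ela≈a i)))
                                     (⨆-upper _ (i , Eq.refl))) ⟩
    ⨆ (Image (a ^_))            ≈⟨ ⋆-⨆ a ⟨
    a ^⋆                        ∎
    where open ≤-Reasoning poset

  E-ω-fixed : ∀ {x a} → a ∈ 𝒜 → E x a ≈ a → Elast x a ≈ a → E x (a ^ω) ≈ a ^ω
  E-ω-fixed {x} {a} a∈𝒜 Ea≈a Ela≈a = antisym Eaω≤aω (E-increasing x _)
    where
    open ≤-Reasoning poset

    E-∞-≤ : E x (a ^∞) ≤ a ^∞
    -- The premise of `E-∞` holds because `E x a` and `Elast x a` both equal `a`.
    E-∞-≤ = reflexive (Eq.trans (E-∞ x a∈𝒜 (Eq.trans Ea≈a (Eq.sym Ela≈a)))
                                (⨾-cong (ω-cong Ea≈a) Eq.refl))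

    Eaω≤aω : E x (a ^ω) ≤ a ^ω
    Eaω≤aω = begin
      E x (a ^ω)          ≈⟨ E-cong x (ω-⋆-∞ a) ⟩
      E x (a ^⋆ ⊔ a ^∞)   ≤⟨ EP.⊔-≤ (trans (E-⋆-≤ Ea≈a Ela≈a) (x≤x∨y _ _))
                                    (trans E-∞-≤ (y≤x∨y _ _)) ⟩
      a ^⋆ ⊔ a ^∞         ≈⟨ ω-⋆-∞ a ⟨
      a ^ω                ∎

  guar-cong : ∀ {g₁ g₂} → g₁ ≐ g₂ → guar g₁ ≈ guar g₂
  guar-cong g₁≐g₂ = ω-cong (⊔-cong (embed-cong π-embedding g₁≐g₂) Eq.refl)

  guar-absorb : ∀ {g₁ g₂} → g₁ ⊆ g₂ → guar g₁ ⋒ guar g₂ ≈ guar g₁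
  guar-absorb {g₁} {g₂} g₁⊆g₂ =
    Eq.trans (guar-⋒ g₁ g₂) (guar-cong (proj₁ , (λ p → p , g₁⊆g₂ p)))

  -- The iterated step `π (Eᵣ x g) ⊔ 𝛆` is atomic, and `E x` and `Elast x` fix each of its two
  -- parts, so `E-ω-fixed` applies.
  E-guar : ∀ x g → E x (guar (Eᵣ x g)) ≈ guar (Eᵣ x g)
  E-guar x g = E-ω-fixed (𝒜-⊔ (π∈𝒜 _) (ε∈𝒜 _))
    (EP.⊔-fixed
      (Eq.trans (E-π x _) (embed-cong π-embedding (Eᵣ-idem x g)))
      (Eq.trans (E-ε x _) (embed-cong ε-embedding
        ((λ _ → tt) , (λ {p} _ → Eᵣ-increasing x Full {p} tt)))))
    (ElastP.⊔-fixed
      (Eq.trans (Elast-π x _) (embed-cong π-embedding (Eᵣlast-Eᵣ x g)))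
      (Eq.trans (Elast-ε x _) (embed-cong ε-embedding
        ((λ _ → tt) , (λ {p} _ → Eᵣlast-increasing x Full {p} tt)))))

  -- Since `g ⊆ Eᵣ x g`, the weaker guarantee can be added under `E x` at no cost; being fixed by
  -- `E x`, it then leaves the scope by `E-⋒`.
  E-⋒-guar : ∀ x c g → E x (c ⋒ guar g) ≈ E x (c ⋒ guar g) ⋒ guar (Eᵣ x g)
  E-⋒-guar x c g = begin
    E x (c ⋒ guar g)
      ≈⟨ E-cong x (⋒-cong Eq.refl (guar-absorb (Eᵣ-increasing x g))) ⟨
    E x (c ⋒ (guar g ⋒ guar (Eᵣ x g)))
      ≈⟨ E-cong x (⋒-assoc _ _ _) ⟨
    E x ((c ⋒ guar g) ⋒ guar (Eᵣ x g))
      ≈⟨ E-cong x (⋒-cong Eq.refl (E-guar x g)) ⟨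
    E x ((c ⋒ guar g) ⋒ E x (guar (Eᵣ x g)))
      ≈⟨ E-⋒ x _ _ ⟩
    E x (c ⋒ guar g) ⋒ E x (guar (Eᵣ x g))
      ≈⟨ ⋒-cong Eq.refl (E-guar x g) ⟩
    E x (c ⋒ guar g) ⋒ guar (Eᵣ x g) ∎
    where open ≈-Reasoning setoid

  local-guar : ∀ x c g → (local x ∙ (c ⋒ guar g)) ≈
                         (local x ∙ (c ⋒ guar g)) ⋒ guar (Eᵣ x g ∩ idAt x)
  local-guar x c g = begin
    E x (d ⋒ (c ⋒ guar g)) ⋒ gₓ
      ≈⟨ ⋒-cong (E-cong x (⋒-assoc _ _ _)) Eq.refl ⟨
    e ⋒ gₓ
      -- `gₓ` is duplicated: one copy rebuilds the local block, the other merges with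
      -- `guar (Eᵣ x g)` into the intersection.
      ≈⟨ ⋒-cong (E-⋒-guar x (d ⋒ c) g) (Eq.sym (⋒-idem gₓ)) ⟩
    (e ⋒ guar (Eᵣ x g)) ⋒ (gₓ ⋒ gₓ)
      ≈⟨ ⋒-interchange _ _ _ _ ⟩
    (e ⋒ gₓ) ⋒ (guar (Eᵣ x g) ⋒ gₓ)
      ≈⟨ ⋒-cong (⋒-cong (E-cong x (⋒-assoc _ _ _)) Eq.refl) (guar-⋒ _ _) ⟩
    (E x (d ⋒ (c ⋒ guar g)) ⋒ gₓ) ⋒ guar (Eᵣ x g ∩ idAt x) ∎
    where
    open ≈-Reasoning setoid
    d  = demand (idAt x)
    gₓ = guar (idAt x)
    e  = E x ((d ⋒ c) ⋒ guar g)

  -- A guarantee distributes over `⨾`, so it can be collected from both factors.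
  ⨾-guar : ∀ {c d g} → c ≈ c ⋒ guar g → d ≈ d ⋒ guar g →
           c ⨾ d ≈ (c ⨾ d) ⋒ guar g
  ⨾-guar {c} {d} {g} c≈c⋒g d≈d⋒g = begin
    c ⨾ d                         ≈⟨ ⨾-cong (Eq.trans c≈c⋒g (⋒-comm _ _))
                                            (Eq.trans d≈d⋒g (⋒-comm _ _)) ⟩
    (guar g ⋒ c) ⨾ (guar g ⋒ d)   ≈⟨ guar-⨾ g c d ⟨
    guar g ⋒ (c ⨾ d)              ≈⟨ ⋒-comm _ _ ⟩
    (c ⨾ d) ⋒ guar g              ∎
    where open ≈-Reasoning setoid

mainTheorem1 : ∀ {ℓ : Level} {V S : Set ℓ} → V ↣ ℕ →
    (𝓐 : LocalisationAlgebra V S) →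
    let open States V S
        open LocalisationAlgebra 𝓐
    in
    (x : V) (c : Command) (g : StateRel) → id ⊆ g →
    (var x ∙ (c ⋒ guar g)) ≈
      (var x ∙ (c ⋒ guar g)) ⋒ guar (Eᵣ x g ∩ idAt x)
mainTheorem1 {V = V} {S = S} _ 𝓐 x c g id⊆g =
  ⨾-guar idle-h (⨾-guar (local-guar x c g) idle-h)
  where
  open States V S
  open RelProperties V S
  open LocalisationAlgebra 𝓐
  open AlgebraProperties 𝓐

  idle-h : idle ≈ idle ⋒ guar (Eᵣ x g ∩ idAt x)
  -- Both relations in the intersection are reflexive: `Eᵣ x g` because it contains `g`, and
  -- `idAt x` by definition.
  idle-h = idle-guar _ (λ p → Eᵣ-increasing x g (id⊆g p) , idOn-refl _ p)
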